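{- For $n\ge 15$, the number of subsets $S\subseteq\{0,1,\dots,n-1\}$ with $|S+S|>|S-S|$ is at least $(2\times10^{ -7})\,2^n$.
   Context: $S+S=\{s_1+s_2: s_1,s_2\in S\}$ and $S-S=\{s_1-s_2: s_1,s_2\in S\}$. -}

module Defs where

open import Data.Nat using (ℕ; zero; suc; _+_; _<?_)
open import Data.Bool using (Bool; true; false)
open import Data.Fin using (Fin; toℕ)
open import Data.Fin.Subset using (Subset; _∈_; ∣_∣; inside; outside)
open import Data.Fin.Subset.Properties using (_∈?_)
open import Data.Fin.Properties using (any?)
open import Data.Integer as ℤ using (ℤ; +_)
import Data.Integer.Properties as ℤP
open import Data.Product using (∃; _×_; _,_)
open import Data.List using (List; []; _∷_; map; _++_; filter; length)
open import Data.Vec using (_∷_; []; tabulate)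
open import Relation.Binary.PropositionalEquality using (_≡_)
open import Relation.Nullary using (Dec; _×-dec_)
open import Relation.Nullary.Decidable using (⌊_⌋)

InSumSet : ∀ {n} → Subset n → ℕ → Set
InSumSet {n} S k = ∃ λ (i : Fin n) → ∃ λ (j : Fin n) → (i ∈ S × j ∈ S) × (toℕ i + toℕ j ≡ k)

inSumSet? : ∀ {n} (S : Subset n) (k : ℕ) → Dec (InSumSet S k)
inSumSet? S k = any? λ i → any? λ j → ((i ∈? S) ×-dec (j ∈? S)) ×-dec (toℕ i + toℕ j Data.Nat.≟ k)
  where import Data.Nat

InDiffSet : ∀ {n} → Subset n → ℤ → Set
InDiffSet {n} S d = ∃ λ (i : Fin n) → ∃ λ (j : Fin n) → (i ∈ S × j ∈ S) × ((+ toℕ i) ℤ.- (+ toℕ j) ≡ d)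

inDiffSet? : ∀ {n} (S : Subset n) (d : ℤ) → Dec (InDiffSet S d)
inDiffSet? S d = any? λ i → any? λ j → ((i ∈? S) ×-dec (j ∈? S)) ×-dec ((+ toℕ i) ℤ.- (+ toℕ j) ℤP.≟ d)

-- S+S as a subset of {0,…,2n-1} (all sums lie in {0,…,2n-2}); position k ↦ sum k
sumSet : ∀ {n} → Subset n → Subset (n + n)
sumSet S = tabulate λ k → ⌊ inSumSet? S (toℕ k) ⌋

-- S-S as a subset of {-n,…,n-1} (all differences lie in {-(n-1),…,n-1}); position k ↦ k - n
diffSet : ∀ {n} → Subset n → Subset (n + n)
diffSet {n} S = tabulate λ k → ⌊ inDiffSet? S ((+ toℕ k) ℤ.- (+ n)) ⌋

sumSetSize : ∀ {n} → Subset n → ℕ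
sumSetSize S = ∣ sumSet S ∣

diffSetSize : ∀ {n} → Subset n → ℕ
diffSetSize S = ∣ diffSet S ∣

allSubsets : (n : ℕ) → List (Subset n)
allSubsets zero = [] ∷ []
allSubsets (suc n) = map (inside ∷_) (allSubsets n) ++ map (outside ∷_) (allSubsets n)

countMSTD : ℕ → ℕ
countMSTD n = length (filter (λ S → diffSetSize S <? sumSetSize S) (allSubsets n))

{-# OPTIONS --safe #-}
module Submission where

-- Write n = 22 + m and consider the sets S = L ∪ (11 + R) ∪ (n − 11 + U) with
-- R ⊆ {0,…,m−1} free and the fringes L = {0,2,3,7,8,9,10} and
-- U = {0,1,2,3,5,8,9,10} fixed.  The fringes prevent ±(n − 7) from being a
-- difference, so |S−S| ≤ 2n − 3.  They already produce all sums except 1 outside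
-- two middle ranges, so |S+S| ≥ 2n − 2 as soon as no sum k of these ranges is
-- missed.  If k = 21 + t is missed, then R has no two elements adding up to t − 1
-- and avoids the 7 positions that would combine with L; this leaves at most a
-- proportion 2⁻⁷ a(t) / 2ᵗ of all R, where a(2s) = a(2s+1) = 3ˢ, and these sum
-- to at most 6 · 2⁻⁷ over t.  The upper range is symmetric and contributes at
-- most 6 · 2⁻⁸, so at least (1 − 18/256) 2ⁿ⁻²² > 2·10⁻⁷ · 2ⁿ sets remain.
-- For n < 22 one set suffices: Conway's {0,2,3,4,7,11,12,14}.

open import Defs
open import Data.Nat using (ℕ; zero; suc; z≤n; s≤s; s≤s⁻¹; _+_; _∸_; _*_; _^_; _≤_; _<_; _≤?_; _<?_; _≟_)
open import Data.Nat.Properties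
open import Data.Nat.Tactic.RingSolver using (solve-∀)
import Data.Integer as ℤ
import Data.Integer.Properties as ℤP
import Data.Integer.Tactic.RingSolver as ℤSolver
open import Data.Bool using (Bool; true; false; if_then_else_)
open import Data.Empty using (⊥)
open import Data.Fin as Fin using (Fin; zero; suc; toℕ; fromℕ; fromℕ<)
open import Data.Fin.Properties using (any?; all?; toℕ<n; toℕ-fromℕ; toℕ-fromℕ<; fromℕ<-injective; toℕ-injective)
open import Data.Fin.Subset using (Subset; inside; outside; _∈_; _∉_; ∣_∣; ∁; ⁅_⁆; _∪_; _-_; ⊤)
open import Data.Fin.Subset.Properties using (_∈?_; ∈⊤; ∣⊤∣≡n; ∣⁅x⁆∣≡1; p⊆q⇒∣p∣≤∣q∣; ∣∁p∣≡n∸∣p∣; x∈∁p⇒x∉p; x∈p∪q⁺; x∈⁅x⁆; x∈p∧x≢y⇒x∈p-y; x∈p⇒∣p-x∣<∣p∣)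
open import Data.List as List using ([]; _∷_; length; filter)
open import Data.List.Properties using (filter-++; length-++)
open import Data.Product using (∃; ∃₂; _×_; _,_; proj₁; proj₂)
open import Data.Sum using (_⊎_; inj₁; inj₂; [_,_]′)
open import Data.Vec using ([]; _∷_; _++_; _∷ʳ_; tabulate; replicate; here; there)
open import Data.Vec.Properties using (lookup∘tabulate; []=⇒lookup; lookup⇒[]=)
open import Function using (_∘_; const)
open import Relation.Binary.PropositionalEquality using (_≡_; _≢_; refl; sym; trans; cong; cong₂; subst; subst₂; module ≡-Reasoning)
open import Relation.Nullary using (Dec; yes; no; does; ¬_; ¬?; contradiction; _×-dec_; _⊎-dec_)
open import Relation.Nullary.Decidable using (⌊_⌋; toWitness; from-yes; map′; dec-true; isYes≗does; decidable-stable)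
open import Relation.Unary using (Decidable)
open import Relation.Unary.Properties using (U?)

private
  variable
    m n : ℕ

-- Counting subsets

-- Recursion on the bits makes conditioning on the first bit definitional and lets `refl` evaluate
-- counts over short words.
count : {P : Subset n → Set} → Decidable P → ℕ
count {zero}  P? = if does (P? []) then 1 else 0
count {suc n} P? = count (P? ∘ (inside ∷_)) + count (P? ∘ (outside ∷_))

length-filter-map : ∀ {A B : Set} {P : B → Set} (P? : Decidable P) (f : A → B) xs →
                    length (filter P? (List.map f xs)) ≡ length (filter (P? ∘ f) xs)
length-filter-map P? f []       = refl
length-filter-map P? f (x ∷ xs) with does (P? (f x))
... | true  = cong suc (length-filter-map P? f xs)
... | false = length-filter-map P? f xs

length-filter-allSubsets : ∀ n {P : Subset n → Set} (P? : Decidable P) →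
                           length (filter P? (allSubsets n)) ≡ count P?
length-filter-allSubsets zero    P? with does (P? [])
... | true  = refl
... | false = refl
length-filter-allSubsets (suc n) P? = begin
  length (filter P? (ins List.++ outs))                     ≡⟨ cong length (filter-++ P? ins outs) ⟩
  length (filter P? ins List.++ filter P? outs)             ≡⟨ length-++ (filter P? ins) ⟩
  length (filter P? ins) + length (filter P? outs)          ≡⟨ cong₂ _+_ (half inside) (half outside) ⟩
  count P?                                                  ∎
  where
  open ≡-Reasoning
  ins  = List.map (inside ∷_) (allSubsets n)
  outs = List.map (outside ∷_) (allSubsets n)
  half : ∀ x → length (filter P? (List.map (x ∷_) (allSubsets n))) ≡ count (P? ∘ (x ∷_))
  half x = trans (length-filter-map P? (x ∷_) (allSubsets n))
                 (length-filter-allSubsets n (P? ∘ (x ∷_)))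

count-∪ : {P Q R : Subset n → Set} (P? : Decidable P) (Q? : Decidable Q) (R? : Decidable R) →
          (∀ S → P S → Q S ⊎ R S) → count P? ≤ count Q? + count R?
count-∪ {zero} P? Q? R? f with P? [] | Q? [] | R? []
... | no _  | _     | _     = z≤n
... | yes _ | yes _ | _     = s≤s z≤n
... | yes _ | no _  | yes _ = s≤s z≤n
... | yes p | no ¬q | no ¬r = contradiction (f [] p) [ ¬q , ¬r ]′
count-∪ {suc n} P? Q? R? f =
  ≤-trans (+-mono-≤ (branch inside) (branch outside))
          (≤-reflexive (shuffle (count (Q? ∘ (inside ∷_))) (count (R? ∘ (inside ∷_)))
                                (count (Q? ∘ (outside ∷_))) (count (R? ∘ (outside ∷_)))))
  where
  branch : ∀ x → count (P? ∘ (x ∷_)) ≤ count (Q? ∘ (x ∷_)) + count (R? ∘ (x ∷_))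
  branch x = count-∪ (P? ∘ (x ∷_)) (Q? ∘ (x ∷_)) (R? ∘ (x ∷_)) (f ∘ (x ∷_))
  shuffle : ∀ a b c d → (a + b) + (c + d) ≡ (a + c) + (b + d)
  shuffle = solve-∀

count-⊥ : {P : Subset n → Set} (P? : Decidable P) → (∀ S → ¬ P S) → count P? ≡ 0
count-⊥ {zero} P? ¬p with P? []
... | yes p = contradiction p (¬p [])
... | no _  = refl
count-⊥ {suc n} P? ¬p =
  cong₂ _+_ (count-⊥ (P? ∘ (inside ∷_)) (¬p ∘ (inside ∷_)))
            (count-⊥ (P? ∘ (outside ∷_)) (¬p ∘ (outside ∷_)))

count-⊤ : {P : Subset n → Set} (P? : Decidable P) → (∀ S → P S) → count P? ≡ 2 ^ n
count-⊤ {zero} P? p with P? []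
... | yes _ = refl
... | no ¬p = contradiction (p []) ¬p
count-⊤ {suc n} P? p =
  cong₂ _+_ (count-⊤ (P? ∘ (inside ∷_)) (p ∘ (inside ∷_)))
            (trans (count-⊤ (P? ∘ (outside ∷_)) (p ∘ (outside ∷_))) (sym (+-identityʳ _)))

count-inhabited : {P : Subset n → Set} (P? : Decidable P) → ∀ S → P S → 1 ≤ count P?
count-inhabited P? [] p with P? []
... | yes _ = ≤-refl
... | no ¬p = contradiction p ¬p
count-inhabited P? (inside ∷ S) p = ≤-trans (count-inhabited (P? ∘ (inside ∷_)) S p) (m≤m+n _ _)
count-inhabited P? (outside ∷ S) p = ≤-trans (count-inhabited (P? ∘ (outside ∷_)) S p) (m≤n+m _ _)

count-mono : {P Q : Subset n → Set} (P? : Decidable P) (Q? : Decidable Q) →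
             (∀ S → P S → Q S) → count P? ≤ count Q?
count-mono P? Q? f = begin
  count P?             ≤⟨ count-∪ P? Q? ∅? (λ S → inj₁ ∘ f S) ⟩
  count Q? + count ∅?  ≡⟨ cong (count Q? +_) (count-⊥ ∅? (λ _ ())) ⟩
  count Q? + 0         ≡⟨ +-identityʳ _ ⟩
  count Q?             ∎
  where
  open ≤-Reasoning
  ∅? : Decidable (const ⊥)
  ∅? _ = no λ ()

-- A prefix satisfying Q has at most `count R?` admissible continuations, and any other prefix has
-- none.
count-++ : {P : Subset (m + n) → Set} {Q : Subset m → Set} {R : Subset n → Set}
           (P? : Decidable P) (Q? : Decidable Q) (R? : Decidable R) →
           (∀ u v → P (u ++ v) → Q u × R v) → count P? ≤ count Q? * count R?
count-++ {zero} P? Q? R? f with Q? []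
... | yes _ = ≤-trans (count-mono P? R? (λ v p → proj₂ (f [] v p))) (m≤m+n _ 0)
... | no ¬q = ≤-reflexive (count-⊥ P? (λ v p → ¬q (proj₁ (f [] v p))))
count-++ {suc m} P? Q? R? f = begin
  count (P? ∘ (inside ∷_)) + count (P? ∘ (outside ∷_))
    ≤⟨ +-mono-≤ (branch inside) (branch outside) ⟩
  count (Q? ∘ (inside ∷_)) * count R? + count (Q? ∘ (outside ∷_)) * count R?
    ≡⟨ *-distribʳ-+ (count R?) (count (Q? ∘ (inside ∷_))) _ ⟨
  count Q? * count R? ∎
  where
  open ≤-Reasoning
  branch : ∀ x → count (P? ∘ (x ∷_)) ≤ count (Q? ∘ (x ∷_)) * count R?
  branch x = count-++ (P? ∘ (x ∷_)) (Q? ∘ (x ∷_)) R? (f ∘ (x ∷_))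

count-∷ : {P : Subset (suc n) → Set} (P? : Decidable P) → ∀ x →
          count (P? ∘ (x ∷_)) ≤ count P?
count-∷ P? inside  = m≤m+n _ _
count-∷ P? outside = m≤n+m _ _

count-prefix : {P : Subset (m + n) → Set} (P? : Decidable P) (u : Subset m) →
               count (P? ∘ (u ++_)) ≤ count P?
count-prefix P? []      = ≤-refl
count-prefix P? (x ∷ u) = ≤-trans (count-prefix (P? ∘ (x ∷_)) u) (count-∷ P? x)

count-suffix : {P : Subset (m + n) → Set} (P? : Decidable P) (v : Subset n) →
               count (λ u → P? (u ++ v)) ≤ count P?
count-suffix {zero} P? v with P? v
... | yes p = count-inhabited P? v p
... | no _  = z≤n
count-suffix {suc m} P? v =
  +-mono-≤ (count-suffix (P? ∘ (inside ∷_)) v) (count-suffix (P? ∘ (outside ∷_)) v)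

-- Peels off the last bit, so that `count-mirrorFree` can shorten a word at both ends at once.
count-∷ʳ : {P : Subset (suc n) → Set} (P? : Decidable P) →
           count P? ≡ count (λ w → P? (w ∷ʳ inside)) + count (λ w → P? (w ∷ʳ outside))
count-∷ʳ {zero}  P? = refl
count-∷ʳ {suc n} P? = begin
  count (P? ∘ (inside ∷_)) + count (P? ∘ (outside ∷_))
    ≡⟨ cong₂ _+_ (count-∷ʳ (P? ∘ (inside ∷_))) (count-∷ʳ (P? ∘ (outside ∷_))) ⟩
  (#[ inside , inside ] + #[ inside , outside ]) + (#[ outside , inside ] + #[ outside , outside ])
    ≡⟨ shuffle #[ inside , inside ] _ _ _ ⟩
  (#[ inside , inside ] + #[ outside , inside ]) + (#[ inside , outside ] + #[ outside , outside ]) ∎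
  where
  open ≡-Reasoning
  #[_,_] : Bool → Bool → ℕ
  #[ x , y ] = count (λ w → P? (x ∷ (w ∷ʳ y)))
  shuffle : ∀ a b c d → (a + b) + (c + d) ≡ (a + c) + (b + d)
  shuffle = solve-∀

-- Sums of positions

-- Positions are natural numbers here, so that in concatenated words they shift by plain addition,
-- without casts between `Fin` types.
data _∋_ : Subset n → ℕ → Set where
  here  : {p : Subset n} → (inside ∷ p) ∋ 0
  there : ∀ {x a} {p : Subset n} → p ∋ a → (x ∷ p) ∋ suc a

∋⇒∈ : ∀ {p : Subset n} {a} → p ∋ a → ∃ λ i → i ∈ p × toℕ i ≡ a
∋⇒∈ here = zero , here , refl
∋⇒∈ (there h) with ∋⇒∈ h
... | i , i∈p , refl = suc i , there i∈p , refl

∈⇒∋ : ∀ {p : Subset n} {i} → i ∈ p → p ∋ toℕ i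
∈⇒∋ here        = here
∈⇒∋ (there i∈p) = there (∈⇒∋ i∈p)

∋-++ˡ : ∀ {p : Subset m} {q : Subset n} {a} → p ∋ a → (p ++ q) ∋ a
∋-++ˡ here      = here
∋-++ˡ (there h) = there (∋-++ˡ h)

∋-++ʳ : ∀ (p : Subset m) {q : Subset n} {a} → q ∋ a → (p ++ q) ∋ (m + a)
∋-++ʳ []      h = h
∋-++ʳ (x ∷ p) h = there (∋-++ʳ p h)

∋-++ʳ⁻ : ∀ (p : Subset m) {q : Subset n} {a} → (p ++ q) ∋ (m + a) → q ∋ a
∋-++ʳ⁻ []      h         = h
∋-++ʳ⁻ (x ∷ p) (there h) = ∋-++ʳ⁻ p h

∋-∷ʳ : ∀ {p : Subset n} {x a} → p ∋ a → (p ∷ʳ x) ∋ a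
∋-∷ʳ here      = here
∋-∷ʳ (there h) = there (∋-∷ʳ h)

∋-last : (p : Subset n) → (p ∷ʳ inside) ∋ n
∋-last []      = here
∋-last (x ∷ p) = there (∋-last p)

SumsTo : Subset m → Subset n → ℕ → Set
SumsTo p q k = ∃₂ λ a b → p ∋ a × q ∋ b × a + b ≡ k

sumsTo? : (p : Subset m) (q : Subset n) → Decidable (SumsTo p q)
sumsTo? p q k = map′ to from
  (any? λ i → any? λ j → (i ∈? p) ×-dec (j ∈? q) ×-dec (toℕ i + toℕ j ≟ k))
  where
  to : (∃₂ λ i j → i ∈ p × j ∈ q × toℕ i + toℕ j ≡ k) → SumsTo p q k
  to (i , j , i∈p , j∈q , eq) = toℕ i , toℕ j , ∈⇒∋ i∈p , ∈⇒∋ j∈q , eq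
  from : SumsTo p q k → ∃₂ λ i j → i ∈ p × j ∈ q × toℕ i + toℕ j ≡ k
  from (a , b , p∋a , q∋b , eq) with ∋⇒∈ p∋a | ∋⇒∈ q∋b
  ... | i , i∈p , refl | j , j∈q , refl = i , j , i∈p , j∈q , eq

inSumSet : ∀ {S : Subset n} {k} → SumsTo S S k → InSumSet S k
inSumSet (a , b , S∋a , S∋b , eq) with ∋⇒∈ S∋a | ∋⇒∈ S∋b
... | i , i∈S , refl | j , j∈S , refl = i , j , (i∈S , j∈S) , eq

-- The extra outside shifts one summand by 1: w has elements a, b with a + b = n − 1.
Mirrored : Subset n → Set
Mirrored {n} w = SumsTo (outside ∷ w) w n

mirrored? : Decidable (Mirrored {n})
mirrored? {n} w = sumsTo? (outside ∷ w) w n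

-- A bit added at each end moves both positions by 1 and the required sum by 2.
mirrored-∷-∷ʳ : ∀ {w : Subset n} x y → Mirrored w → Mirrored (x ∷ (w ∷ʳ y))
mirrored-∷-∷ʳ x y (suc a , b , there w∋a , w∋b , eq) =
  suc (suc a) , suc b , there (there (∋-∷ʳ w∋a)) , there (∋-∷ʳ w∋b) ,
  cong (2 +_) (trans (+-suc a b) eq)

mirrored-ends : (w : Subset n) → Mirrored (inside ∷ (w ∷ʳ inside))
mirrored-ends {n} w = 1 , suc n , there here , there (∋-last w) , refl

-- Words without mirrored pairs

mirrorFree : ℕ → ℕ
mirrorFree 0             = 1
mirrorFree 1             = 1
mirrorFree (suc (suc t)) = 3 * mirrorFree t

-- Two mirror positions may hold anything but `inside` twice, which leaves three choices per pair.
-- In odd length the middle bit is its own mirror image and must be `outside`.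
count-mirrorFree : ∀ t {P : Subset t → Set} (P? : Decidable P) →
                   (∀ w → P w → ¬ Mirrored w) → count P? ≤ mirrorFree t
count-mirrorFree 0 P? f with does (P? [])
... | true  = ≤-refl
... | false = z≤n
count-mirrorFree 1 P? f with P? (inside ∷ []) | does (P? (outside ∷ []))
... | yes p | _     = contradiction (1 , 0 , there here , here , refl) (f _ p)
... | no _  | true  = ≤-refl
... | no _  | false = z≤n
count-mirrorFree (suc (suc t)) P? f = begin
  count (P? ∘ (inside ∷_)) + count (P? ∘ (outside ∷_))
    ≡⟨ cong₂ _+_ (count-∷ʳ (P? ∘ (inside ∷_))) (count-∷ʳ (P? ∘ (outside ∷_))) ⟩
  (count (ends inside inside) + count (ends inside outside)) +
  (count (ends outside inside) + count (ends outside outside))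
    -- Two `inside` ends already form a mirrored pair, so this quarter is empty.
    ≤⟨ +-mono-≤ (+-mono-≤ (≤-reflexive (count-⊥ (ends inside inside) (λ w p → f _ p (mirrored-ends w))))
                          (inner inside outside))
                (+-mono-≤ (inner outside inside) (inner outside outside)) ⟩
  (0 + mirrorFree t) + (mirrorFree t + mirrorFree t)
    ≡⟨ triple (mirrorFree t) ⟩
  3 * mirrorFree t ∎
  where
  open ≤-Reasoning
  ends : ∀ x y → Decidable _
  ends x y w = P? (x ∷ (w ∷ʳ y))
  inner : ∀ x y → count (ends x y) ≤ mirrorFree t
  inner x y = count-mirrorFree t (ends x y) (λ w p → f _ p ∘ mirrored-∷-∷ʳ x y)
  triple : ∀ a → (0 + a) + (a + a) ≡ 3 * a
  triple = solve-∀

-- mirrorTail t = ∑ⱼ mirrorFree (t + j) / 2ʲ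
mirrorTail : ℕ → ℕ
mirrorTail 0             = 6
mirrorTail 1             = 10
mirrorTail (suc (suc t)) = 3 * mirrorTail t

-- Splits off the first term of the series; doubling clears the factor 1/2 of the remaining terms.
-- The starting values are 6 = (1 + 1/2) / (1 - 3/4) and 10 = 2 · (6 - 1).
mirrorTail-step : ∀ t → 2 * mirrorFree t + mirrorTail (suc t) ≡ 2 * mirrorTail t
mirrorTail-step 0             = refl
mirrorTail-step 1             = refl
mirrorTail-step (suc (suc t)) = begin
  2 * (3 * mirrorFree t) + 3 * mirrorTail (suc t)  ≡⟨ factor (mirrorFree t) (mirrorTail (suc t)) ⟩
  3 * (2 * mirrorFree t + mirrorTail (suc t))      ≡⟨ cong (3 *_) (mirrorTail-step t) ⟩
  3 * (2 * mirrorTail t)                           ≡⟨ swap (mirrorTail t) ⟩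
  2 * (3 * mirrorTail t)                           ∎
  where
  open ≡-Reasoning
  factor : ∀ a b → 2 * (3 * a) + 3 * b ≡ 3 * (2 * a + b)
  factor = solve-∀
  swap : ∀ a → 3 * (2 * a) ≡ 2 * (3 * a)
  swap = solve-∀

mirrorFree≤mirrorTail : ∀ t → mirrorFree t ≤ mirrorTail t
mirrorFree≤mirrorTail 0             = s≤s z≤n
mirrorFree≤mirrorTail 1             = s≤s z≤n
mirrorFree≤mirrorTail (suc (suc t)) = *-monoʳ-≤ 3 (mirrorFree≤mirrorTail t)

-- Union bounds

-- The two indices move together with constant sum, because the bound on a single event depends on
-- both: t unpaired bits and r free bits.
Somewhere : (ℕ → ℕ → Set) → ℕ → ℕ → Set
Somewhere F t zero    = F t zero
Somewhere F t (suc r) = F t (suc r) ⊎ Somewhere F (suc t) r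

somewhere? : {F : ℕ → ℕ → Set} → (∀ t r → Dec (F t r)) → ∀ t r → Dec (Somewhere F t r)
somewhere? F? t zero    = F? t zero
somewhere? F? t (suc r) = F? t (suc r) ⊎-dec somewhere? F? (suc t) r

somewhere⁺ : {F : ℕ → ℕ → Set} → ∀ d {t} r → F (d + t) r → Somewhere F t (d + r)
somewhere⁺ zero    zero    h = h
somewhere⁺ zero    (suc r) h = inj₁ h
somewhere⁺ {F} (suc d) {t} r h = inj₂ (somewhere⁺ d r (subst (λ s → F s r) (sym (+-suc d t)) h))

-- The j-th event after t contributes at most C · `mirrorFree (t + j)` · 2^(r - j), so the total is
-- at most C · 2^r times a partial sum of the series `mirrorTail t`.
count-somewhere : ∀ N C {F : Subset n → ℕ → ℕ → Set} (F? : ∀ S t r → Dec (F S t r)) →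
                  (∀ t r → t + r ≡ N → count (λ S → F? S t r) ≤ C * (mirrorFree t * 2 ^ r)) →
                  ∀ t r → t + r ≡ N →
                  count (λ S → somewhere? (F? S) t r) ≤ C * (mirrorTail t * 2 ^ r)
count-somewhere N C F? bound t zero eq =
  ≤-trans (bound t zero eq) (*-monoʳ-≤ C (*-monoˡ-≤ 1 (mirrorFree≤mirrorTail t)))
count-somewhere N C F? bound t (suc r) eq = begin
  count (λ S → somewhere? (F? S) t (suc r))
    ≤⟨ count-∪ _ (λ S → F? S t (suc r)) (λ S → somewhere? (F? S) (suc t) r) (λ _ h → h) ⟩
  count (λ S → F? S t (suc r)) + count (λ S → somewhere? (F? S) (suc t) r)
    ≤⟨ +-mono-≤ (bound t (suc r) eq)
                (count-somewhere N C F? bound (suc t) r (trans (sym (+-suc t r)) eq)) ⟩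
  C * (mirrorFree t * (2 * 2 ^ r)) + C * (mirrorTail (suc t) * 2 ^ r)
    ≡⟨ factor C (mirrorFree t) (mirrorTail (suc t)) (2 ^ r) ⟩
  C * ((2 * mirrorFree t + mirrorTail (suc t)) * 2 ^ r)
    ≡⟨ cong (λ x → C * (x * 2 ^ r)) (mirrorTail-step t) ⟩
  C * (2 * mirrorTail t * 2 ^ r)
    ≡⟨ swap C (mirrorTail t) (2 ^ r) ⟩
  C * (mirrorTail t * 2 ^ suc r) ∎
  where
  open ≤-Reasoning
  factor : ∀ c a b x → c * (a * (2 * x)) + c * (b * x) ≡ c * ((2 * a + b) * x)
  factor = solve-∀
  swap : ∀ c a x → c * (2 * a * x) ≡ c * (a * (2 * x))
  swap = solve-∀

-- Cardinalities of sum sets and difference sets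

∈-tabulate⁺ : {P : Fin n → Set} (P? : Decidable P) → ∀ {k} → P k → k ∈ tabulate (λ k → ⌊ P? k ⌋)
∈-tabulate⁺ P? {k} p = lookup⇒[]= k _ (trans (lookup∘tabulate _ k) (trans (isYes≗does (P? k)) (dec-true (P? k) p)))

∈-tabulate⁻ : {P : Fin n → Set} (P? : Decidable P) → ∀ {k} → k ∈ tabulate (λ k → ⌊ P? k ⌋) → P k
∈-tabulate⁻ P? {k} h with P? k | trans (sym (lookup∘tabulate (λ k → ⌊ P? k ⌋) k)) ([]=⇒lookup h)
... | yes p | _ = p
... | no _  | ()

∣p∪q∣≤∣p∣+∣q∣ : (p q : Subset n) → ∣ p ∪ q ∣ ≤ ∣ p ∣ + ∣ q ∣
∣p∪q∣≤∣p∣+∣q∣ []            []            = z≤n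
∣p∪q∣≤∣p∣+∣q∣ (inside  ∷ p) (inside  ∷ q) =
  s≤s (≤-trans (∣p∪q∣≤∣p∣+∣q∣ p q) (+-monoʳ-≤ ∣ p ∣ (n≤1+n ∣ q ∣)))
∣p∪q∣≤∣p∣+∣q∣ (inside  ∷ p) (outside ∷ q) = s≤s (∣p∪q∣≤∣p∣+∣q∣ p q)
∣p∪q∣≤∣p∣+∣q∣ (outside ∷ p) (inside  ∷ q) =
  ≤-trans (s≤s (∣p∪q∣≤∣p∣+∣q∣ p q)) (≤-reflexive (sym (+-suc ∣ p ∣ ∣ q ∣)))
∣p∪q∣≤∣p∣+∣q∣ (outside ∷ p) (outside ∷ q) = ∣p∪q∣≤∣p∣+∣q∣ p q

two-missing : (p : Subset n) (a b : Fin n) → (∀ k → k ≢ a → k ≢ b → k ∈ p) → n ≤ 2 + ∣ p ∣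
two-missing {n} p a b f = begin
  n                        ≤⟨ m≤n+m∸n n ∣ p ∣ ⟩
  ∣ p ∣ + (n ∸ ∣ p ∣)      ≡⟨ cong (∣ p ∣ +_) (∣∁p∣≡n∸∣p∣ p) ⟨
  ∣ p ∣ + ∣ ∁ p ∣          ≤⟨ +-monoʳ-≤ ∣ p ∣ (p⊆q⇒∣p∣≤∣q∣ {q = ⁅ a ⁆ ∪ ⁅ b ⁆} ∁p⊆) ⟩
  ∣ p ∣ + ∣ ⁅ a ⁆ ∪ ⁅ b ⁆ ∣  ≤⟨ +-monoʳ-≤ ∣ p ∣ (∣p∪q∣≤∣p∣+∣q∣ ⁅ a ⁆ ⁅ b ⁆) ⟩
  ∣ p ∣ + (∣ ⁅ a ⁆ ∣ + ∣ ⁅ b ⁆ ∣)  ≡⟨ cong (∣ p ∣ +_) (cong₂ _+_ (∣⁅x⁆∣≡1 a) (∣⁅x⁆∣≡1 b)) ⟩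
  ∣ p ∣ + 2                ≡⟨ +-comm ∣ p ∣ 2 ⟩
  2 + ∣ p ∣                ∎
  where
  open ≤-Reasoning
  ∁p⊆ : ∀ {k} → k ∈ ∁ p → k ∈ ⁅ a ⁆ ∪ ⁅ b ⁆
  ∁p⊆ {k} k∈∁p with k Fin.≟ a | k Fin.≟ b
  ... | yes refl | _        = x∈p∪q⁺ (inj₁ (x∈⁅x⁆ a))
  ... | no _     | yes refl = x∈p∪q⁺ (inj₂ (x∈⁅x⁆ b))
  ... | no k≢a   | no k≢b   = contradiction (f k k≢a k≢b) (x∈∁p⇒x∉p k∈∁p)

-- Each of the three removals from `⊤` costs at least one element, since distinctness keeps the next
-- one present.
three-missing : (p : Subset n) {a b c : Fin n} → a ∉ p → b ∉ p → c ∉ p →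
                b ≢ a → c ≢ a → c ≢ b → 3 + ∣ p ∣ ≤ n
three-missing {n} p {a} {b} {c} a∉p b∉p c∉p b≢a c≢a c≢b = begin-strict
  2 + ∣ p ∣                ≤⟨ +-monoʳ-≤ 2 (p⊆q⇒∣p∣≤∣q∣ {q = ⊤ - a - b - c} p⊆) ⟩
  2 + ∣ ⊤ - a - b - c ∣    ≤⟨ s≤s (x∈p⇒∣p-x∣<∣p∣ (x∈p∧x≢y⇒x∈p-y (x∈p∧x≢y⇒x∈p-y ∈⊤ c≢a) c≢b)) ⟩
  1 + ∣ ⊤ - a - b ∣        ≤⟨ x∈p⇒∣p-x∣<∣p∣ (x∈p∧x≢y⇒x∈p-y ∈⊤ b≢a) ⟩
  ∣ ⊤ - a ∣                <⟨ x∈p⇒∣p-x∣<∣p∣ {x = a} ∈⊤ ⟩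
  ∣ ⊤ {n} ∣                ≡⟨ ∣⊤∣≡n n ⟩
  n                        ∎
  where
  open ≤-Reasoning
  p⊆ : ∀ {k} → k ∈ p → k ∈ ⊤ - a - b - c
  p⊆ k∈p = x∈p∧x≢y⇒x∈p-y (x∈p∧x≢y⇒x∈p-y (x∈p∧x≢y⇒x∈p-y ∈⊤
    (λ { refl → a∉p k∈p })) (λ { refl → b∉p k∈p })) (λ { refl → c∉p k∈p })

difference-cross : ∀ a b c d → ℤ.+ a ℤ.- ℤ.+ b ≡ ℤ.+ c ℤ.- ℤ.+ d → a + d ≡ c + b
difference-cross a b c d eq = ℤP.+-injective (begin
  ℤ.+ (a + d)                                      ≡⟨ ℤP.pos-+ a d ⟩
  ℤ.+ a ℤ.+ ℤ.+ d                                  ≡⟨ regroup (ℤ.+ a) (ℤ.+ b) (ℤ.+ d) ⟩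
  (ℤ.+ a ℤ.- ℤ.+ b) ℤ.+ (ℤ.+ b ℤ.+ ℤ.+ d)          ≡⟨ cong (ℤ._+ (ℤ.+ b ℤ.+ ℤ.+ d)) eq ⟩
  (ℤ.+ c ℤ.- ℤ.+ d) ℤ.+ (ℤ.+ b ℤ.+ ℤ.+ d)          ≡⟨ regroup′ (ℤ.+ c) (ℤ.+ b) (ℤ.+ d) ⟩
  ℤ.+ c ℤ.+ ℤ.+ b                                  ≡⟨ ℤP.pos-+ c b ⟨
  ℤ.+ (c + b)                                      ∎)
  where
  open ≡-Reasoning
  regroup : ∀ x y z → x ℤ.+ z ≡ (x ℤ.- y) ℤ.+ (y ℤ.+ z)
  regroup = ℤSolver.solve-∀
  regroup′ : ∀ x y z → (x ℤ.- z) ℤ.+ (y ℤ.+ z) ≡ x ℤ.+ y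
  regroup′ = ℤSolver.solve-∀

-- Position k of `diffSet` stands for k - n, so 0, h and g + n stand for -n, -g and g. The first is
-- out of range for every set, and the gap excludes the other two.
diffSetSize-gap : (S : Subset n) → ∀ g h → 0 < g → 0 < h → g + h ≡ n →
                  (∀ {a b} → S ∋ a → S ∋ b → b ≢ g + a) → 3 + diffSetSize S ≤ n + n
diffSetSize-gap {n} S g h 0<g 0<h g+h≡n gap =
  three-missing (diffSet S) (missing 0<2n missing-n) (missing h<2n missing-gap) (missing top<2n missing+gap)
    (distinct h<2n 0<2n 0<h) (distinct top<2n 0<2n (≤-trans 0<g (m≤m+n g n))) (distinct top<2n h<2n h<top)
  where
  open ≤-Reasoning
  h<n : h < n
  h<n = subst (h <_) g+h≡n (+-monoˡ-≤ h 0<g)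
  h<top : h < g + n
  h<top = ≤-trans h<n (m≤n+m n g)
  h<2n : h < n + n
  h<2n = ≤-trans h<n (m≤m+n n n)
  0<2n : 0 < n + n
  0<2n = ≤-trans (s≤s z≤n) h<2n
  top<2n : g + n < n + n
  top<2n = +-monoˡ-< n (subst₂ _<_ (+-identityʳ g) g+h≡n (+-monoʳ-< g 0<h))
  missing : ∀ {k} (k<2n : k < n + n) → ¬ InDiffSet S (ℤ.+ k ℤ.- ℤ.+ n) → fromℕ< k<2n ∉ diffSet S
  missing k<2n ¬d k∈ = ¬d (subst (λ k → InDiffSet S (ℤ.+ k ℤ.- ℤ.+ n)) (toℕ-fromℕ< k<2n)
    (∈-tabulate⁻ (λ k → inDiffSet? S (ℤ.+ toℕ k ℤ.- ℤ.+ n)) k∈))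
  distinct : ∀ {k l} (k<2n : k < n + n) (l<2n : l < n + n) → l < k → fromℕ< k<2n ≢ fromℕ< l<2n
  distinct k<2n l<2n l<k eq = <⇒≢ l<k (sym (fromℕ<-injective _ _ k<2n l<2n eq))
  missing-n : ¬ InDiffSet S (ℤ.+ 0 ℤ.- ℤ.+ n)
  missing-n (i , j , _ , eq) = <-irrefl (sym (difference-cross (toℕ i) (toℕ j) 0 n eq))
    (≤-trans (toℕ<n j) (m≤n+m n (toℕ i)))
  missing-gap : ¬ InDiffSet S (ℤ.+ h ℤ.- ℤ.+ n)
  missing-gap (i , j , (i∈S , j∈S) , eq) = gap (∈⇒∋ i∈S) (∈⇒∋ j∈S) (+-cancelˡ-≡ h _ _ (begin-equality
    h + toℕ j        ≡⟨ difference-cross (toℕ i) (toℕ j) h n eq ⟨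
    toℕ i + n        ≡⟨ cong (toℕ i +_) g+h≡n ⟨
    toℕ i + (g + h)  ≡⟨ rotate (toℕ i) g h ⟩
    h + (g + toℕ i)  ∎))
    where
    rotate : ∀ i g h → i + (g + h) ≡ h + (g + i)
    rotate = solve-∀
  missing+gap : ¬ InDiffSet S (ℤ.+ (g + n) ℤ.- ℤ.+ n)
  missing+gap (i , j , (i∈S , j∈S) , eq) = gap (∈⇒∋ j∈S) (∈⇒∋ i∈S) (+-cancelʳ-≡ n _ _ (begin-equality
    toℕ i + n        ≡⟨ difference-cross (toℕ i) (toℕ j) (g + n) n eq ⟩
    g + n + toℕ j    ≡⟨ rotate g n (toℕ j) ⟩
    g + toℕ j + n    ∎))
    where
    rotate : ∀ g n j → (g + n) + j ≡ (g + j) + n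
    rotate = solve-∀

-- Only two positions are given up: 1, and 2n - 1, which exceeds the largest possible sum 2n - 2.
sumSetSize-all : (S : Subset n) → 2 ≤ n → (∀ k → k ≢ 1 → suc k < n + n → InSumSet S k) →
                 n + n ≤ 2 + sumSetSize S
sumSetSize-all {suc n} S 2≤n sums = two-missing (sumSet S) (fromℕ< 1<2n) (fromℕ (n + suc n)) covered
  where
  1<2n : 1 < suc n + suc n
  1<2n = ≤-trans 2≤n (m≤m+n _ _)
  covered : ∀ k → k ≢ fromℕ< 1<2n → k ≢ fromℕ (n + suc n) → k ∈ sumSet S
  covered k k≢1 k≢last = ∈-tabulate⁺ (λ k → inSumSet? S (toℕ k)) (sums (toℕ k)
    (λ eq → k≢1 (toℕ-injective (trans eq (sym (toℕ-fromℕ< 1<2n)))))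
    (≤∧≢⇒< (toℕ<n k) (λ eq → k≢last (toℕ-injective (trans (suc-injective eq) (sym (toℕ-fromℕ _)))))))

-- Sets with prescribed fringes

-- Shifting `lower` by 4 makes it disjoint from `upper`, while the sums within and between the
-- fringes fill 0 to 20, apart from 1 in `lower` + `lower`.
lower upper : Subset 11
lower = inside ∷ outside ∷ inside ∷ inside ∷ outside ∷ outside ∷ outside ∷ inside ∷ inside ∷ inside ∷ inside ∷ []
upper = inside ∷ inside ∷ inside ∷ inside ∷ outside ∷ inside ∷ outside ∷ outside ∷ inside ∷ inside ∷ inside ∷ []

frame : Subset m → Subset (11 + (m + 11))
frame R = lower ++ (R ++ upper)

frame-lower : (R : Subset m) → ∀ {a} → lower ∋ a → frame R ∋ a
frame-lower R = ∋-++ˡ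

frame-middle : (R : Subset m) → ∀ {a} → R ∋ a → frame R ∋ (11 + a)
frame-middle R R∋a = ∋-++ʳ lower (∋-++ˡ R∋a)

frame-upper : (R : Subset m) → ∀ {a} → upper ∋ a → frame R ∋ (11 + (m + a))
frame-upper R U∋a = ∋-++ʳ lower (∋-++ʳ R U∋a)

-- A difference m + 15 puts the larger element at place 4 + a of `upper`. This forces a ≤ 6, so a is
-- 0, 2 or 3, but `upper` lacks 4, 6 and 7.
frame-gap : (R : Subset m) → ∀ {a b} → frame R ∋ a → frame R ∋ b → b ≢ (m + 15) + a
frame-gap {m} R {a} S∋a S∋b refl =
  clash S∋a (∋-++ʳ⁻ R (∋-++ʳ⁻ lower (subst (frame R ∋_) (shift m a) S∋b)))
  where
  shift : ∀ m a → (m + 15) + a ≡ 11 + (m + (4 + a))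
  shift = solve-∀
  clash : ∀ {a} → frame R ∋ a → upper ∋ (4 + a) → ⊥
  clash here (there (there (there (there ()))))
  clash (there (there here)) (there (there (there (there (there (there ()))))))
  clash (there (there (there here))) (there (there (there (there (there (there (there ())))))))
  -- Now a ≥ 7, so 4 + a is past the end of `upper`.
  clash (there (there (there (there (there (there (there _)))))))
        (there (there (there (there (there (there (there (there (there (there (there ())))))))))))

fin-bounded : ∀ {c} {P : ℕ → Set} → (∀ (i : Fin c) → P (toℕ i)) → ∀ {d} → d < c → P d
fin-bounded {P = P} f d<c = subst P (toℕ-fromℕ< d<c) (f (fromℕ< d<c))

-- Checked by evaluation up to 20 = 10 + 10, the largest sum of two fringe elements.
lower+lower : ∀ {d} → d < 21 → d ≡ 1 ⊎ SumsTo lower lower d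
lower+lower = fin-bounded (toWitness {a? = all? {n = 21} λ d → (toℕ d ≟ 1) ⊎-dec sumsTo? lower lower (toℕ d)} _)

lower+upper : ∀ {d} → d < 21 → SumsTo lower upper d
lower+upper = fin-bounded (toWitness {a? = all? {n = 21} λ d → sumsTo? lower upper (toℕ d)} _)

upper+upper : ∀ {d} → d < 21 → SumsTo upper upper d
upper+upper = fin-bounded (toWitness {a? = all? {n = 21} λ d → sumsTo? upper upper (toℕ d)} _)

-- The sums that the fringes alone do not produce; those below n are indexed by
-- t = k − 21, those above by r = k − (m + 32).
LowMiss HighMiss : Subset m → ℕ → ℕ → Set
LowMiss      R t r = ¬ InSumSet (frame R) (21 + t)
HighMiss {m} R t r = ¬ InSumSet (frame R) (m + (32 + r))

lowMiss? : (R : Subset m) → ∀ t r → Dec (LowMiss R t r)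
lowMiss? R t r = ¬? (inSumSet? (frame R) (21 + t))

highMiss? : (R : Subset m) → ∀ t r → Dec (HighMiss R t r)
highMiss? {m} R t r = ¬? (inSumSet? (frame R) (m + (32 + r)))

split : ∀ c k → k < c ⊎ ∃ λ d → c + d ≡ k
split c k with k <? c
... | yes k<c = inj₁ k<c
... | no  k≮c = inj₂ (m≤n⇒∃[o]m+o≡n (≮⇒≥ k≮c))

frame-lower+lower : (R : Subset m) → ∀ {d} → SumsTo lower lower d → InSumSet (frame R) d
frame-lower+lower R (a , b , La , Lb , eq) = inSumSet (a , b , frame-lower R La , frame-lower R Lb , eq)

frame-lower+upper : (R : Subset m) → ∀ {d} → SumsTo lower upper d → InSumSet (frame R) ((m + 11) + d)
frame-lower+upper {m} R (a , b , La , Ub , refl) =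
  inSumSet (a , 11 + (m + b) , frame-lower R La , frame-upper R Ub , shift m a b)
  where
  shift : ∀ m a b → a + (11 + (m + b)) ≡ (m + 11) + (a + b)
  shift = solve-∀

frame-upper+upper : (R : Subset m) → ∀ {d} → SumsTo upper upper d → InSumSet (frame R) ((m + 22) + (m + d))
frame-upper+upper {m} R (a , b , Ua , Ub , refl) =
  inSumSet (11 + (m + a) , 11 + (m + b) , frame-upper R Ua , frame-upper R Ub , shift m a b)
  where
  shift : ∀ m a b → (11 + (m + a)) + (11 + (m + b)) ≡ (m + 22) + (m + (a + b))
  shift = solve-∀

-- Five ranges of k follow each other: `lower` + `lower` from 0, the first hypothesis from 21,
-- `lower` + `upper` from m + 11, the second hypothesis from m + 32, and `upper` + `upper` from 2m +
-- 22 to 2m + 42 = 2n - 2. For m ≤ 10 the second and fourth are empty.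
frame-sums : (R : Subset m) →
             (∀ t r → t + (11 + r) ≡ m → ¬ LowMiss R t r) →
             (∀ t r → t + (11 + r) ≡ m → ¬ HighMiss R t r) →
             ∀ k → k ≢ 1 → suc k < (11 + (m + 11)) + (11 + (m + 11)) → InSumSet (frame R) k
frame-sums {m} R low high k k≢1 k<2n = [ below-21 , beyond-21 ]′ (split 21 k)
  where
  In : ℕ → Set
  In = InSumSet (frame R)

  below-21 : k < 21 → In k
  below-21 k<21 = [ (λ k≡1 → contradiction k≡1 k≢1) , frame-lower+lower R ]′ (lower+lower k<21)

  beyond-m+32 : ∀ e → (m + 11) + (21 + e) ≡ k → In k
  -- With k = m + 32 + e, the last range is reached exactly when m ≤ e + 10.
  beyond-m+32 e eq = [ below , above ]′ (split m (e + 10))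
    where
    below : e + 10 < m → In k
    below e+10<m = let t , e+11+t≡m = m≤n⇒∃[o]m+o≡n e+10<m in subst In (trans (shift₁ m e) eq)
      (decidable-stable (inSumSet? (frame R) _) (high t e (trans (shift₂ t e) e+11+t≡m)))
      where
      shift₁ : ∀ m e → m + (32 + e) ≡ (m + 11) + (21 + e)
      shift₁ = solve-∀
      shift₂ : ∀ t e → t + (11 + e) ≡ suc (e + 10) + t
      shift₂ = solve-∀
    above : (∃ λ f → m + f ≡ e + 10) → In k
    above (f , m+f≡e+10) = subst In k≡ (frame-upper+upper R (upper+upper f<21))
      where
      shift₁ : ∀ m e → (m + 22) + (e + 10) ≡ (m + 11) + (21 + e)
      shift₁ = solve-∀
      k≡ : (m + 22) + (m + f) ≡ k
      k≡ = trans (cong ((m + 22) +_) m+f≡e+10) (trans (shift₁ m e) eq)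
      shift₂ : ∀ m f → suc (suc ((m + 22) + (m + f))) ≡ (m + 22 + m) + (2 + f)
      shift₂ = solve-∀
      shift₃ : ∀ m → (11 + (m + 11)) + (11 + (m + 11)) ≡ (m + 22 + m) + 22
      shift₃ = solve-∀
      f<21 : f < 21
      f<21 = s≤s⁻¹ (+-cancelˡ-≤ (m + 22 + m) (2 + f) 22
        (subst₂ _≤_ (trans (cong (2 +_) (sym k≡)) (shift₂ m f)) (shift₃ m) k<2n))

  beyond-m+11 : (∃ λ d → (m + 11) + d ≡ k) → In k
  beyond-m+11 (d , eq) = [ (λ d<21 → subst In eq (frame-lower+upper R (lower+upper d<21))) , above ]′ (split 21 d)
    where
    above : (∃ λ e → 21 + e ≡ d) → In k
    above (e , 21+e≡d) = beyond-m+32 e (trans (cong ((m + 11) +_) 21+e≡d) eq)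

  beyond-21 : (∃ λ t → 21 + t ≡ k) → In k
  beyond-21 (t , eq) = [ below , beyond-m+11 ]′ (split (m + 11) k)
    where
    shift : ∀ t → suc (21 + t) ≡ t + 11 + 11
    shift = solve-∀
    below : k < m + 11 → In k
    below k<m+11 =
      let r , t+11+r≡m = m≤n⇒∃[o]m+o≡n (+-cancelʳ-≤ 11 (t + 11) m
                           (subst (_≤ m + 11) (trans (cong suc (sym eq)) (shift t)) k<m+11))
      in subst In eq
      (decidable-stable (inSumSet? (frame R) _) (low t r (trans (sym (+-assoc t 11 r)) t+11+r≡m)))

MSTD : Subset n → Set
MSTD S = diffSetSize S < sumSetSize S

mstd? : Decidable (MSTD {n})
mstd? S = diffSetSize S <? sumSetSize S

frame-mstd : (R : Subset m) →
             (∀ t r → t + (11 + r) ≡ m → ¬ LowMiss R t r) →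
             (∀ t r → t + (11 + r) ≡ m → ¬ HighMiss R t r) →
             MSTD (frame R)
frame-mstd {m} R low high = +-cancelˡ-≤ 2 _ _ (≤-trans
  -- The gap is m + 15 = n - 7. Three lost positions against two make the inequality strict.
  (diffSetSize-gap (frame R) (m + 15) 7 (≤-trans (s≤s z≤n) (m≤n+m 15 m)) (s≤s z≤n) (shift m) (frame-gap R))
  (sumSetSize-all (frame R) (s≤s (s≤s z≤n)) (frame-sums R low high)))
  where
  shift : ∀ m → m + 15 + 7 ≡ 11 + (m + 11)
  shift = solve-∀

-- Middles that miss a given sum

unpaired? : Decidable (λ (w : Subset n) → ¬ Mirrored w)
unpaired? w = ¬? (mirrored? w)

avoids? : (F : Subset m) → ∀ k → Decidable (λ (v : Subset n) → ¬ SumsTo F v k)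
avoids? F k v = ¬? (sumsTo? F v k)

-- Each element a of `lower` forbids position 10 - a. Seven of the 11 bits are thereby fixed,
-- leaving 2⁴ words; the eight elements of `upper` leave 2³.
count-avoids-lower : count (avoids? {n = 11} lower 10) ≡ 16
count-avoids-lower = refl

count-avoids-upper : count (avoids? {n = 11} upper 10) ≡ 8
count-avoids-upper = refl

-- A missed low sum splits R into an unpaired block w of length t, a block of
-- length 11 that avoids the mirror image of the lower fringe, and r free bits.
count-lowMiss : ∀ t r → t + (11 + r) ≡ m →
                count (λ (R : Subset m) → lowMiss? R t r) ≤ 16 * (mirrorFree t * 2 ^ r)
count-lowMiss t r refl = begin
  count (λ (R : Subset (t + (11 + r))) → lowMiss? R t r)
    ≤⟨ count-++ {t} {11 + r} (λ R → lowMiss? R t r) unpaired? (avoids? lower 10)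
         (λ w v miss → unpaired w v miss , avoiding w v miss) ⟩
  count (unpaired? {t}) * count (avoids? {n = 11 + r} lower 10)
    ≤⟨ *-mono-≤ (count-mirrorFree t unpaired? (λ _ h → h))
                (count-++ {11} {r} (avoids? lower 10) (avoids? lower 10) U? (λ v z h → restrict v z h , _)) ⟩
  mirrorFree t * (count (avoids? {n = 11} lower 10) * count (U? {A = Subset r}))
    ≡⟨ cong (mirrorFree t *_) (cong₂ _*_ count-avoids-lower (count-⊤ {r} U? _)) ⟩
  mirrorFree t * (16 * 2 ^ r)
    ≡⟨ swap (mirrorFree t) (2 ^ r) ⟩
  16 * (mirrorFree t * 2 ^ r) ∎
  where
  open ≤-Reasoning
  swap : ∀ a b → a * (16 * b) ≡ 16 * (a * b)
  swap = solve-∀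
  -- Positions adding up to t - 1, both shifted by 11, give the missed sum 21 + t.
  unpaired : ∀ (w : Subset t) (v : Subset (11 + r)) → LowMiss (w ++ v) t r → ¬ Mirrored w
  unpaired w v miss (suc a , b , there w∋a , w∋b , eq) = miss (inSumSet
    (11 + a , 11 + b , frame-middle (w ++ v) (∋-++ˡ w∋a) , frame-middle (w ++ v) (∋-++ˡ w∋b) ,
     trans (shift a b) (cong (λ s → 21 + s) eq)))
    where
    shift : ∀ a b → (11 + a) + (11 + b) ≡ 21 + suc (a + b)
    shift = solve-∀
  -- The block v starts at 11 + t, so its position 10 - a completes a fringe element a to 21 + t.
  avoiding : ∀ (w : Subset t) (v : Subset (11 + r)) → LowMiss (w ++ v) t r → ¬ SumsTo lower v 10
  avoiding w v miss (a , b , L∋a , v∋b , eq) = miss (inSumSet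
    (a , 11 + (t + b) , frame-lower (w ++ v) L∋a , frame-middle (w ++ v) (∋-++ʳ w v∋b) ,
     trans (shift₁ a b t) (trans (cong (λ s → 11 + (t + s)) eq) (shift₂ t))))
    where
    shift₁ : ∀ a b t → a + (11 + (t + b)) ≡ 11 + (t + (a + b))
    shift₁ = solve-∀
    shift₂ : ∀ t → 11 + (t + 10) ≡ 21 + t
    shift₂ = solve-∀
  restrict : ∀ (v : Subset 11) (z : Subset r) → ¬ SumsTo lower (v ++ z) 10 → ¬ SumsTo lower v 10
  restrict v z h (a , b , L∋a , v∋b , eq) = h (a , b , L∋a , ∋-++ˡ v∋b , eq)

-- The reflection of `count-lowMiss`: the r free bits come first, then 11 bits restricted by
-- `upper`, then t unpaired bits.
count-highMiss : ∀ t r → (r + 11) + t ≡ m →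
                 count (λ (R : Subset m) → highMiss? R t r) ≤ 8 * (mirrorFree t * 2 ^ r)
count-highMiss t r refl = begin
  count (λ (R : Subset (r + 11 + t)) → highMiss? R t r)
    ≤⟨ count-++ {r + 11} {t} (λ R → highMiss? R t r) (avoids? upper (r + 10)) unpaired?
         (λ v w miss → avoiding v w miss , unpaired v w miss) ⟩
  count (avoids? {n = r + 11} upper (r + 10)) * count (unpaired? {t})
    ≤⟨ *-mono-≤ (count-++ {r} {11} (avoids? upper (r + 10)) U? (avoids? upper 10) (λ z v h → _ , restrict z v h))
                (count-mirrorFree t unpaired? (λ _ h → h)) ⟩
  (count (U? {A = Subset r}) * count (avoids? {n = 11} upper 10)) * mirrorFree t
    ≡⟨ cong (_* mirrorFree t) (cong₂ _*_ (count-⊤ {r} U? _) count-avoids-upper) ⟩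
  (2 ^ r * 8) * mirrorFree t
    ≡⟨ swap (mirrorFree t) (2 ^ r) ⟩
  8 * (mirrorFree t * 2 ^ r) ∎
  where
  open ≤-Reasoning
  swap : ∀ a b → (b * 8) * a ≡ 8 * (a * b)
  swap = solve-∀
  unpaired : ∀ (v : Subset (r + 11)) (w : Subset t) → HighMiss (v ++ w) t r → ¬ Mirrored w
  unpaired v w miss (suc a , b , there w∋a , w∋b , eq) = miss (inSumSet
    (11 + ((r + 11) + a) , 11 + ((r + 11) + b) ,
     frame-middle (v ++ w) (∋-++ʳ v w∋a) , frame-middle (v ++ w) (∋-++ʳ v w∋b) ,
     trans (shift a b r) (cong (λ s → ((r + 11) + s) + (32 + r)) eq)))
    where
    shift : ∀ a b r → (11 + ((r + 11) + a)) + (11 + ((r + 11) + b)) ≡ ((r + 11) + suc (a + b)) + (32 + r)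
    shift = solve-∀
  avoiding : ∀ (v : Subset (r + 11)) (w : Subset t) → HighMiss (v ++ w) t r → ¬ SumsTo upper v (r + 10)
  avoiding v w miss (a , b , U∋a , v∋b , eq) = miss (inSumSet
    (11 + (((r + 11) + t) + a) , 11 + b , frame-upper (v ++ w) U∋a , frame-middle (v ++ w) (∋-++ˡ v∋b) ,
     trans (shift₁ a b ((r + 11) + t)) (trans (cong (λ s → ((r + 11) + t) + (22 + s)) eq) (shift₂ ((r + 11) + t) r))))
    where
    shift₁ : ∀ a b m → (11 + (m + a)) + (11 + b) ≡ m + (22 + (a + b))
    shift₁ = solve-∀
    shift₂ : ∀ m r → m + (22 + (r + 10)) ≡ m + (32 + r)
    shift₂ = solve-∀
  -- The last 11 bits start at offset r, which turns the sum 10 into r + 10.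
  restrict : ∀ (z : Subset r) (v : Subset 11) → ¬ SumsTo upper (z ++ v) (r + 10) → ¬ SumsTo upper v 10
  restrict z v h (a , b , U∋a , v∋b , eq) =
    h (a , r + b , U∋a , ∋-++ʳ z v∋b , trans (shift a b r) (cong (r +_) eq))
    where
    shift : ∀ a b r → a + (r + b) ≡ r + (a + b)
    shift = solve-∀

-- 2048 = 2¹¹ and 144 = 16 · 6 + 8 · 6.
count-frame-mstd : ∀ N → 11 + N ≡ m →
                   2048 * 2 ^ N ≤ count (λ (R : Subset m) → mstd? (frame R)) + 144 * 2 ^ N
count-frame-mstd {m} N 11+N≡m = begin
  2048 * 2 ^ N
    ≡⟨ ^-distribˡ-+-* 2 11 N ⟨
  2 ^ (11 + N)
    ≡⟨ cong (2 ^_) 11+N≡m ⟩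
  2 ^ m
    ≡⟨ count-⊤ {m} U? _ ⟨
  count {m} U?
    ≤⟨ count-∪ U? (λ R → mstd? (frame R)) miss? (λ R _ → dichotomy R) ⟩
  #mstd + count miss?
    ≤⟨ +-monoʳ-≤ #mstd (count-∪ miss? (λ R → somewhere? (lowMiss? R) 0 N) (λ R → somewhere? (highMiss? R) 0 N) (λ _ h → h)) ⟩
  #mstd + (count (λ (R : Subset m) → somewhere? (lowMiss? R) 0 N) +
           count (λ (R : Subset m) → somewhere? (highMiss? R) 0 N))
    ≤⟨ +-monoʳ-≤ #mstd (+-mono-≤
         (count-somewhere {m} N 16 lowMiss? (λ t r eq → count-lowMiss t r (trans (shift₁ t r) (trans (cong (11 +_) eq) 11+N≡m))) 0 N refl)
         (count-somewhere {m} N 8 highMiss? (λ t r eq → count-highMiss t r (trans (shift₂ t r) (trans (cong (11 +_) eq) 11+N≡m))) 0 N refl)) ⟩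
  #mstd + (16 * (6 * 2 ^ N) + 8 * (6 * 2 ^ N))
    ≡⟨ cong (#mstd +_) (collect (2 ^ N)) ⟩
  #mstd + 144 * 2 ^ N ∎
  where
  open ≤-Reasoning
  #mstd : ℕ
  #mstd = count (λ (R : Subset m) → mstd? (frame R))
  miss? : (R : Subset m) → Dec (Somewhere (LowMiss R) 0 N ⊎ Somewhere (HighMiss R) 0 N)
  miss? R = somewhere? (lowMiss? R) 0 N ⊎-dec somewhere? (highMiss? R) 0 N
  shift₁ : ∀ t r → t + (11 + r) ≡ 11 + (t + r)
  shift₁ = solve-∀
  shift₂ : ∀ t r → (r + 11) + t ≡ 11 + (t + r)
  shift₂ = solve-∀
  collect : ∀ x → 16 * (6 * x) + 8 * (6 * x) ≡ 144 * x
  collect = solve-∀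
  -- The indices with t + r = N are those with t + (11 + r) = m, so the disjunction reaches every
  -- possible miss.
  locate : ∀ {F : ℕ → ℕ → Set} t r → t + (11 + r) ≡ m → F t r → Somewhere F 0 N
  locate {F} t r eq h = subst (Somewhere F 0) (+-cancelˡ-≡ 11 _ _ (trans (sym (shift₁ t r)) (trans eq (sym 11+N≡m))))
    (somewhere⁺ t r (subst (λ t → F t r) (sym (+-identityʳ t)) h))
  dichotomy : ∀ R → MSTD (frame R) ⊎ (Somewhere (LowMiss R) 0 N ⊎ Somewhere (HighMiss R) 0 N)
  dichotomy R = decide (miss? R)
    where
    decide : Dec (Somewhere (LowMiss R) 0 N ⊎ Somewhere (HighMiss R) 0 N) → _
    decide (yes h) = inj₂ h
    decide (no ¬h) = inj₁ (frame-mstd R (λ t r eq → ¬h ∘ inj₁ ∘ locate t r eq)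
                                        (λ t r eq → ¬h ∘ inj₂ ∘ locate t r eq))

-- Lower bounds for the number of sets

mstd-inhabited : (S : Subset n) → MSTD S → 1 ≤ countMSTD n
mstd-inhabited {n} S S-mstd =
  subst (1 ≤_) (sym (length-filter-allSubsets n mstd?)) (count-inhabited mstd? S S-mstd)

-- Fixing both ends can only lose sets, so good middles bound the number of good sets from below.
count-extensions : ∀ {k l} (u : Subset k) (v : Subset l) → k + (m + l) ≡ n →
                   count (λ (R : Subset m) → mstd? (u ++ (R ++ v))) ≤ countMSTD n
count-extensions {m} {k = k} {l} u v refl = begin
  count (λ (R : Subset m) → mstd? (u ++ (R ++ v)))      ≤⟨ count-suffix {m} (λ T → mstd? (u ++ T)) v ⟩
  count (λ (T : Subset (m + l)) → mstd? (u ++ T))       ≤⟨ count-prefix mstd? u ⟩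
  count (mstd? {k + (m + l)})                           ≡⟨ length-filter-allSubsets (k + (m + l)) mstd? ⟨
  countMSTD (k + (m + l))                               ∎
  where open ≤-Reasoning

conway : Subset 15
conway = inside ∷ outside ∷ inside ∷ inside ∷ inside ∷ outside ∷ outside ∷ inside ∷ outside ∷ outside ∷ outside ∷ inside ∷ inside ∷ outside ∷ inside ∷ []

-- Padding with `outside` leaves the set of elements unchanged; the seven lengths 15 to 21 are
-- evaluated one by one.
conway-mstd : ∀ {e} → e < 7 → MSTD (conway ++ replicate e outside)
conway-mstd = fin-bounded {P = λ e → MSTD (conway ++ replicate e outside)}
  (toWitness {a? = all? {n = 7} λ e → mstd? (conway ++ replicate (toℕ e) outside)} _)

theorem14-small : ∀ e → e < 7 → 2 * 2 ^ (15 + e) ≤ 10000000 * countMSTD (15 + e)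
theorem14-small e e<7 = begin
  2 ^ (16 + e)                  ≤⟨ ^-monoʳ-≤ 2 (+-monoʳ-≤ 16 (s≤s⁻¹ e<7)) ⟩
  -- 2²² = 4194304 is below 10⁷, so a single set is enough.
  2 ^ 22                        ≤⟨ from-yes (2 ^ 22 ≤? 10000000) ⟩
  10000000 * 1                  ≤⟨ *-monoʳ-≤ 10000000 (mstd-inhabited (conway ++ replicate e outside) (conway-mstd e<7)) ⟩
  10000000 * countMSTD (15 + e) ∎
  where open ≤-Reasoning

-- Since 2 · 2ⁿ = 2²³ · 2ᵐ for n = 22 + m, a share of 2²³ / 10⁷ < 0.84 of all middles is enough.
count-frame-proportion : ∀ m → 2 ^ 23 * 2 ^ m ≤ 10000000 * count (λ (R : Subset m) → mstd? (frame R))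
count-frame-proportion m = [ narrow , wide ]′ (split 11 m)
  where
  open ≤-Reasoning
  narrow : m < 11 → 2 ^ 23 * 2 ^ m ≤ 10000000 * count (λ (R : Subset m) → mstd? (frame R))
  -- For m < 11 there is no sum left to the middle, so every R qualifies.
  narrow m<11 = begin
    2 ^ 23 * 2 ^ m                                          ≤⟨ *-monoˡ-≤ (2 ^ m) (from-yes (2 ^ 23 ≤? 10000000)) ⟩
    10000000 * 2 ^ m                                        ≡⟨ cong (10000000 *_) (count-⊤ (λ R → mstd? (frame R)) (λ R → frame-mstd R (none {LowMiss R}) (none {HighMiss R}))) ⟨
    10000000 * count (λ (R : Subset m) → mstd? (frame R))   ∎
    where
    none : ∀ {F : ℕ → ℕ → Set} t r → t + (11 + r) ≡ m → ¬ F t r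
    none t r refl _ = contradiction m<11 (≤⇒≯ (≤-trans (m≤m+n 11 r) (m≤n+m (11 + r) t)))
  wide : (∃ λ N → 11 + N ≡ m) → 2 ^ 23 * 2 ^ m ≤ 10000000 * count (λ (R : Subset m) → mstd? (frame R))
  wide (N , 11+N≡m) = begin
    2 ^ 23 * 2 ^ m             ≡⟨ cong (λ k → 2 ^ 23 * 2 ^ k) 11+N≡m ⟨
    2 ^ 23 * 2 ^ (11 + N)      ≡⟨ cong (2 ^ 23 *_) (^-distribˡ-+-* 2 11 N) ⟩
    2 ^ 23 * (2 ^ 11 * 2 ^ N)  ≡⟨ *-assoc (2 ^ 23) (2 ^ 11) (2 ^ N) ⟨
    -- Here 1904 = 2048 - 144, and 2³⁴ is about 1.718 · 10¹⁰, below 1.904 · 10¹⁰.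
    2 ^ 34 * 2 ^ N             ≤⟨ *-monoˡ-≤ (2 ^ N) (from-yes (2 ^ 34 ≤? 10000000 * 1904)) ⟩
    10000000 * 1904 * 2 ^ N    ≡⟨ *-assoc 10000000 1904 (2 ^ N) ⟩
    10000000 * (1904 * 2 ^ N)  ≤⟨ *-monoʳ-≤ 10000000 enough ⟩
    10000000 * count (λ (R : Subset m) → mstd? (frame R)) ∎
    where
    enough : 1904 * 2 ^ N ≤ count (λ (R : Subset m) → mstd? (frame R))
    enough = +-cancelʳ-≤ (144 * 2 ^ N) _ _
      (≤-trans (≤-reflexive (sym (*-distribʳ-+ (2 ^ N) 1904 144))) (count-frame-mstd N 11+N≡m))

double-power : ∀ c m {n} → c + m ≡ n → 2 * 2 ^ n ≡ 2 ^ suc c * 2 ^ m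
double-power c m refl = ^-distribˡ-+-* 2 (suc c) m

theorem14-large : ∀ m {n} → 22 + m ≡ n → 2 * 2 ^ n ≤ 10000000 * countMSTD n
theorem14-large m {n} 22+m≡n = begin
  2 * 2 ^ n               ≡⟨ double-power 22 m 22+m≡n ⟩
  2 ^ 23 * 2 ^ m          ≤⟨ count-frame-proportion m ⟩
  10000000 * count (λ (R : Subset m) → mstd? (frame R))
                          ≤⟨ *-monoʳ-≤ 10000000 framed ⟩
  10000000 * countMSTD n  ∎
  where
  open ≤-Reasoning
  shift : ∀ m → 11 + (m + 11) ≡ 22 + m
  shift = solve-∀
  framed : count (λ (R : Subset m) → mstd? (frame R)) ≤ countMSTD n
  framed = count-extensions lower upper (trans (shift m) 22+m≡n)

theorem14 : (n : ℕ) → 15 ≤ n → 2 * 2 ^ n ≤ 10000000 * countMSTD n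
theorem14 n 15≤n = [ small , large ]′ (split 22 n)
  where
  Bound : ℕ → Set
  Bound n = 2 * 2 ^ n ≤ 10000000 * countMSTD n
  -- 22 = 11 + 11 is the least length with room for both fringes.
  small : n < 22 → Bound n
  small n<22 = let e , 15+e≡n = m≤n⇒∃[o]m+o≡n 15≤n in
    subst Bound 15+e≡n (theorem14-small e (+-cancelˡ-< 15 e 7 (subst (_< 22) (sym 15+e≡n) n<22)))
  large : (∃ λ m → 22 + m ≡ n) → Bound n
  large (m , 22+m≡n) = theorem14-large m 22+m≡n
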